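{- Suppose $2^{\aleph_0} \geq \aleph_2$. Then the Keisler criterion fails; that is, the following statement is false: for every countable first-order language $\mathcal{L}$ and any two $\mathcal{L}$-structures $\mathbf{M}, \mathbf{N}$ of size $\leq 2^{\aleph_0}$, $\mathbf{M} \equiv \mathbf{N}$ if and only if there exists an ultrafilter $\mathcal{U}$ on $\omega$ such that $\mathbf{M}^{\omega}/\mathcal{U} \simeq \mathbf{N}^{\omega}/\mathcal{U}$.
   Context: The ambient theory is ZFC. The size of a structure is the cardinality of its universe. $\mathbf{M} \equiv \mathbf{N}$ denotes elementary equivalence (the two structures satisfy the same first-order sentences of their common language), $\mathbf{M}^{\omega}/\mathcal{U}$ denotes the ultrapower of $\mathbf{M}$ by the ultrafilter $\mathcal{U}$ on $\omega$, and $\simeq$ denotes isomorphism of structures. -}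

module Defs where

open import Data.Bool using (Bool)
open import Data.Empty using (⊥)
open import Data.Fin using (Fin; zero; suc)
open import Data.Nat using (ℕ; zero; suc)
import Data.Nat as ℕ
open import Data.Product using (Σ; Σ-syntax; ∃; ∃-syntax; _×_; _,_; proj₁; proj₂)
open import Data.Sum using (_⊎_)
open import Data.Vec.Functional using (Vector; []; _∷_)
open import Function.Base using (_∘_)
open import Function.Bundles using (Func; Injection; Bijection; Surjection; _↣_; _⇔_)
open import Induction.WellFounded using (WellFounded)
open import Level using (0ℓ; _⊔_)
import Level
open import Relation.Binary.Bundles using (Setoid; StrictTotalOrder)
import Relation.Binary.Construct.On as On
open import Relation.Binary.Morphism.Structures using (IsOrderIsomorphism)
open import Relation.Binary.PropositionalEquality using (_≡_; _→-setoid_)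
open import Relation.Nullary using (¬_)
open import Relation.Unary using (Pred; _∈_; _⊆_; _∩_; ∁; ∅; U)

-- Sets are setoids.  Agda's type theory has neither excluded middle nor
-- the axiom of choice for setoids, so a theorem of ZFC takes both as
-- hypotheses.

AxiomOfChoice : ∀ a ℓ₁ b ℓ₂ → Set (Level.suc (a ⊔ ℓ₁ ⊔ b ⊔ ℓ₂))
AxiomOfChoice a ℓ₁ b ℓ₂ =
  {A : Setoid a ℓ₁} {B : Setoid b ℓ₂} (f : Surjection A B) →
  Σ[ g ∈ Func B A ]
    (∀ y → Setoid._≈_ B (Surjection.to f (Func.to g y)) y)

infix 4 _≼_

_≼_ : Setoid 0ℓ 0ℓ → Setoid 0ℓ 0ℓ → Set
A ≼ B = Injection A B

-- The set of functions from ω to 2, under pointwise equality.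
2^ω : Setoid 0ℓ 0ℓ
2^ω = ℕ →-setoid Bool

-- Ordinals are represented by well-ordered sets.
record WellOrder : Set₁ where
  field
    strictTotalOrder : StrictTotalOrder 0ℓ 0ℓ 0ℓ

  open StrictTotalOrder strictTotalOrder public
    using (Carrier; _≈_; _<_; isStrictTotalOrder)

  setoid : Setoid 0ℓ 0ℓ
  setoid = StrictTotalOrder.Eq.setoid strictTotalOrder

  field
    wellFounded : WellFounded _<_

  segment : Carrier → Setoid 0ℓ 0ℓ
  segment x = On.setoid {B = Σ[ y ∈ Carrier ] y < x} setoid proj₁

-- IsAleph n α: the order type of α is the initial ordinal ℵₙ.  That is,
-- ℵ₀ is ω, and ℵₙ₊₁ is the least ordinal not injecting into ℵₙ; since
-- the smaller ordinals are the proper initial segments, leastness says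
-- that each of those does inject into ℵₙ.
IsAleph : ℕ → WellOrder → Set₁
IsAleph zero α =
  Level.Lift _ (∃[ f ] IsOrderIsomorphism α._≈_ _≡_ α._<_ ℕ._<_ f)
  where module α = WellOrder α
IsAleph (suc n) α =
  Σ[ κ ∈ WellOrder ]
    IsAleph n κ
    × ¬ (α.setoid ≼ WellOrder.setoid κ)
    × (∀ x → α.segment x ≼ WellOrder.setoid κ)
  where module α = WellOrder α

2^ℵ₀≥ℵ₂ : Set₁
2^ℵ₀≥ℵ₂ = Σ[ α ∈ WellOrder ] IsAleph 2 α × (WellOrder.setoid α ≼ 2^ω)

record Language : Set₁ where
  field
    Fun : ℕ → Set
    Rel : ℕ → Set

-- Finite languages count as countable.
Countable : Language → Set
Countable ℒ = (Σ ℕ Fun ⊎ Σ ℕ Rel) ↣ ℕ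
  where open Language ℒ

-- Variables are de Bruijn indices.
data Term (ℒ : Language) (n : ℕ) : Set where
  var : Fin n → Term ℒ n
  fun : ∀ {k} → Language.Fun ℒ k → Vector (Term ℒ n) k → Term ℒ n

-- The other connectives and ∃ are definable, the ambient logic being
-- classical.
data Formula (ℒ : Language) : ℕ → Set where
  ⊥′   : ∀ {n} → Formula ℒ n
  _≈′_ : ∀ {n} → Term ℒ n → Term ℒ n → Formula ℒ n
  rel  : ∀ {n k} → Language.Rel ℒ k → Vector (Term ℒ n) k → Formula ℒ n
  _⇒′_ : ∀ {n} → Formula ℒ n → Formula ℒ n → Formula ℒ n
  ∀′_  : ∀ {n} → Formula ℒ (suc n) → Formula ℒ n

Sentence : Language → Set
Sentence ℒ = Formula ℒ 0

record Structure (ℒ : Language) : Set₁ where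
  open Language ℒ
  field
    domain : Setoid 0ℓ 0ℓ

  open Setoid domain public

  field
    nonempty : Carrier
    ⟦_⟧ᶠ     : ∀ {k} → Fun k → Vector Carrier k → Carrier
    ⟦_⟧ʳ     : ∀ {k} → Rel k → Pred (Vector Carrier k) 0ℓ
    ᶠ-cong   : ∀ {k} (f : Fun k) {xs ys : Vector Carrier k} →
               (∀ i → xs i ≈ ys i) → ⟦ f ⟧ᶠ xs ≈ ⟦ f ⟧ᶠ ys
    ʳ-resp   : ∀ {k} (r : Rel k) {xs ys : Vector Carrier k} →
               (∀ i → xs i ≈ ys i) → xs ∈ ⟦ r ⟧ʳ → ys ∈ ⟦ r ⟧ʳ

module _ {ℒ : Language} (M : Structure ℒ) where
  open Structure M

  eval : ∀ {n} → Vector Carrier n → Term ℒ n → Carrier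
  eval ρ (var i)    = ρ i
  eval ρ (fun f ts) = ⟦ f ⟧ᶠ (λ i → eval ρ (ts i))

  Satisfies : ∀ {n} → Vector Carrier n → Formula ℒ n → Set
  Satisfies ρ ⊥′         = ⊥
  Satisfies ρ (s ≈′ t)   = eval ρ s ≈ eval ρ t
  Satisfies ρ (rel r ts) = (λ i → eval ρ (ts i)) ∈ ⟦ r ⟧ʳ
  Satisfies ρ (φ ⇒′ ψ)   = Satisfies ρ φ → Satisfies ρ ψ
  Satisfies ρ (∀′ φ)     = ∀ x → Satisfies (x ∷ ρ) φ

infix 4 _⊨_ _≡ₑ_ _≃_

_⊨_ : ∀ {ℒ} → Structure ℒ → Sentence ℒ → Set
M ⊨ φ = Satisfies M [] φ

_≡ₑ_ : ∀ {ℒ} → Structure ℒ → Structure ℒ → Set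
_≡ₑ_ {ℒ} M N = (φ : Sentence ℒ) → M ⊨ φ ⇔ N ⊨ φ

record _≃_ {ℒ : Language} (M N : Structure ℒ) : Set where
  private
    module M = Structure M
    module N = Structure N
  open Language ℒ
  field
    bijection : Bijection M.domain N.domain

  open Bijection bijection public using (to)

  field
    fun-homo : ∀ {k} (f : Fun k) (xs : Vector M.Carrier k) →
               to (M.⟦ f ⟧ᶠ xs) N.≈ N.⟦ f ⟧ᶠ (to ∘ xs)
    rel-homo : ∀ {k} (r : Rel k) (xs : Vector M.Carrier k) →
               (xs ∈ M.⟦ r ⟧ʳ) ⇔ ((to ∘ xs) ∈ N.⟦ r ⟧ʳ)

record Ultrafilter : Set₁ where
  field
    Large     : Pred (Pred ℕ 0ℓ) 0ℓ
    universal : Large U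
    proper    : ¬ Large ∅
    upward    : ∀ {A B} → A ⊆ B → Large A → Large B
    meet      : ∀ {A B} → Large A → Large B → Large (A ∩ B)
    ultra     : ∀ A → Large A ⊎ Large (∁ A)

  ⋂-large : ∀ {k} (A : Fin k → Pred ℕ 0ℓ) →
            (∀ i → Large (A i)) → Large (λ n → ∀ i → n ∈ A i)
  ⋂-large {zero}  A A-large = upward (λ _ ()) universal
  ⋂-large {suc k} A A-large =
    upward (λ { (h , t) zero → h ; (h , t) (suc i) → t i })
           (meet (A-large zero) (⋂-large (A ∘ suc) (A-large ∘ suc)))

-- Elements of the ultrapower are represented by sequences.
_^ω/_ : ∀ {ℒ} → Structure ℒ → Ultrafilter → Structure ℒ
M ^ω/ 𝒰 = record
  { domain = record
      { Carrier = ℕ → M.Carrier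
      ; _≈_     = λ x y → Large (λ n → x n M.≈ y n)
      ; isEquivalence = record
          { refl  = upward (λ _ → M.refl) universal
          ; sym   = upward M.sym
          ; trans = λ p q → upward (λ { (u , v) → M.trans u v }) (meet p q)
          }
      }
  ; nonempty = λ _ → M.nonempty
  ; ⟦_⟧ᶠ = λ f xs n → M.⟦ f ⟧ᶠ (λ i → xs i n)
  ; ⟦_⟧ʳ = λ r xs → Large (λ n → (λ i → xs i n) ∈ M.⟦ r ⟧ʳ)
  ; ᶠ-cong = λ f {xs} {ys} p →
      upward (M.ᶠ-cong f) (⋂-large (λ i n → xs i n M.≈ ys i n) p)
  ; ʳ-resp = λ r {xs} {ys} p q →
      upward (λ { (u , v) → M.ʳ-resp r u v })
             (meet (⋂-large (λ i n → xs i n M.≈ ys i n) p) q)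
  }
  where
    module M = Structure M
    open Ultrafilter 𝒰

KeislerCriterion : Set₁
KeislerCriterion =
  (ℒ : Language) → Countable ℒ →
  (M N : Structure ℒ) →
  Structure.domain M ≼ 2^ω → Structure.domain N ≼ 2^ω →
  M ≡ₑ N ⇔ (Σ[ 𝒰 ∈ Ultrafilter ] (M ^ω/ 𝒰) ≃ (N ^ω/ 𝒰))

{-# OPTIONS --safe #-}

-- Let K and A be initial ordinals of cardinality ℵ₁ and ℵ₂.  The lexicographic
-- products K × ℚ and A × ℚ are dense linear orders without endpoints, so they
-- are elementarily equivalent.  As every countable subset of K or of A is
-- bounded, the diagonal sequences are cofinal in any ultrapower over ω.
-- An isomorphism of the ultrapowers would therefore yield a cofinal map K → A,
-- contradicting the regularity of ℵ₂.

module Submission where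

open import Defs
open import Axiom.ExcludedMiddle using (ExcludedMiddle)
open import Axiom.UniquenessOfIdentityProofs.WithK using (uip)
open import Data.Bool using (Bool; true; false)
open import Data.Empty using (⊥; ⊥-elim)
open import Data.Fin using (Fin; zero; suc)
open import Data.Integer using (+_; -[1+_])
open import Data.Nat using (ℕ; zero; suc)
import Data.Nat as ℕ
import Data.Nat.Induction as ℕ
import Data.Nat.Properties as ℕ
open import Data.Product
  using (Σ-syntax; ∃; ∃-syntax; _×_; _,_; proj₁; proj₂)
open import Data.Product.Function.NonDependent.Propositional using (_×-↣_)
open import Data.Product.Relation.Binary.Lex.Strict
  using (×-Lex; ×-transitive; ×-compare; ×-wellFounded)
open import Data.Rational using (ℚ; mkℚ; 0ℚ; 1ℚ)
import Data.Rational as ℚ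
import Data.Rational.Properties as ℚ
open import Data.Sum using (inj₁; inj₂; [_,_]′)
open import Data.Unit using (⊤; tt)
open import Data.Vec.Functional using (Vector; []; _∷_)
open import Function.Base using (_∘_; _on_; flip)
open import Function.Bundles
  using (Func; Injection; Bijection; Equivalence; _↣_; _⇔_; mk↣; mk⇔)
open import Function.Construct.Composition using (injection; _↣-∘_)
open import Function.Construct.Identity using (↣-id)
open import Function.Construct.Symmetry using (⇔-sym)
open import Function.Definitions using (Injective)
open import Induction.WellFounded
  using (WellFounded; Acc; acc; WfRec; module All; module FixPoint)
open import Level using (0ℓ; lift)
open import Relation.Binary.Bundles using (Setoid; module StrictTotalOrder)
open import Relation.Binary.Consequences using (tri⇒irr)
import Relation.Binary.Construct.On as On
open import Relation.Binary.Core using (Rel)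
open import Relation.Binary.Definitions
  using (Transitive; Trichotomous; tri<; tri≈; tri>)
open import Relation.Binary.Morphism.Structures using (module IsOrderIsomorphism)
open import Relation.Binary.PropositionalEquality
  using (_≡_; _≢_; refl; sym; trans; cong; cong₂; subst; subst₂; resp₂;
         setoid; isEquivalence)
open import Relation.Nullary using (¬_; yes; no)
open import Relation.Nullary.Decidable using (recompute; decidable-stable)
open import Relation.Unary using (Pred)

-- Linear orders, density and bounds of finite families.

record LinearOrder : Set₁ where
  infix 4 _<_
  field
    Carrier : Set
    _<_     : Rel Carrier 0ℓ
    <-trans : Transitive _<_
    compare : Trichotomous _≡_ _<_

  irrefl : ∀ {x} → ¬ (x < x)
  irrefl = tri⇒irr compare refl

  ≮-<-trans : ∀ {x y z} → ¬ (y < x) → y < z → x < z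
  ≮-<-trans {x} {y} y≮x y<z with compare x y
  ... | tri< x<y _    _   = <-trans x<y y<z
  ... | tri≈ _   refl _   = y<z
  ... | tri> _   _    y<x = ⊥-elim (y≮x y<x)

opposite : LinearOrder → LinearOrder
opposite A = record
  { Carrier = Carrier
  ; _<_     = flip _<_
  ; <-trans = flip <-trans
  ; compare = compare′
  }
  where
  open LinearOrder A
  compare′ : Trichotomous _≡_ (flip _<_)
  compare′ x y with compare x y
  ... | tri< a b c = tri> c b a
  ... | tri≈ a b c = tri≈ c b a
  ... | tri> a b c = tri< c b a

_×ₗₑₓ_ : LinearOrder → LinearOrder → LinearOrder
A ×ₗₑₓ B = record
  { Carrier = A.Carrier × B.Carrier
  ; _<_     = ×-Lex _≡_ A._<_ B._<_
  ; <-trans = ×-transitive {_<₂_ = B._<_} isEquivalence (resp₂ A._<_) A.<-trans B.<-trans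
  ; compare = compare
  }
  where
  module A = LinearOrder A
  module B = LinearOrder B
  compare : Trichotomous _≡_ (×-Lex _≡_ A._<_ B._<_)
  compare x y with ×-compare sym A.compare B.compare x y
  ... | tri< a b c           = tri< a (λ { refl → b (refl , refl) }) c
  ... | tri≈ a (refl , refl) c = tri≈ a refl c
  ... | tri> a b c           = tri> a (λ { refl → b (refl , refl) }) c

record DLO : Set₁ where
  field
    linearOrder : LinearOrder
  open LinearOrder linearOrder public
  field
    inhabitant : Carrier
    dense      : ∀ {x y} → x < y → ∃[ z ] x < z × z < y
    below      : ∀ x → ∃[ y ] y < x
    above      : ∀ x → ∃[ y ] x < y

module _ (A : LinearOrder) where
  open LinearOrder A

  -- The statement is relative to a set C so that its order dual can provide
  -- the hypotheses about the set of lower bounds of a finite family.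
  above-finite : ExcludedMiddle 0ℓ →
    (C : Pred Carrier 0ℓ) → ∃ C → (∀ {x} → C x → ∃[ y ] C y × x < y) →
    ∀ {n} (P : Pred (Fin n) 0ℓ) (σ : Vector Carrier n) →
    (∀ {i} → P i → C (σ i)) →
    ∃[ y ] C y × (∀ {i} → P i → σ i < y)
  above-finite em C (c , Cc) next {zero}  P σ P⇒C = c , Cc , λ { {()} }
  above-finite em C C≢∅ next {suc n} P σ P⇒C
    with above-finite em C C≢∅ next (P ∘ suc) (σ ∘ suc) P⇒C | em {P zero}
  ... | y , Cy , σ<y | no ¬P0 =
    y , Cy , λ { {zero} P0 → ⊥-elim (¬P0 P0) ; {suc i} → σ<y }
  ... | y , Cy , σ<y | yes P0 with em {σ zero < y}
  ...   | yes σ0<y = y , Cy , λ { {zero} _ → σ0<y ; {suc i} → σ<y }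
  ...   | no  σ0≮y with next (P⇒C P0)
  ...     | z , Cz , σ0<z =
    z , Cz , λ { {zero} _ → σ0<z
               ; {suc i} Pi → <-trans (σ<y Pi) (≮-<-trans σ0≮y σ0<z) }

-- Elementary equivalence of dense linear orders by back-and-forth.

data Less : ℕ → Set where
  less : Less 2

orderLanguage : Language
orderLanguage = record { Fun = λ _ → ⊥ ; Rel = Less }

orderLanguage-countable : Countable orderLanguage
orderLanguage-countable =
  mk↣ {to = λ _ → 0} λ { {inj₂ (_ , less)} {inj₂ (_ , less)} _ → refl }

orderStructure : DLO → Structure orderLanguage
orderStructure A = record
  { domain   = setoid Carrier
  ; nonempty = inhabitant
  ; ⟦_⟧ᶠ     = λ ()
  ; ⟦_⟧ʳ     = λ { less xs → xs zero < xs (suc zero) }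
  ; ᶠ-cong   = λ ()
  ; ʳ-resp   = λ { less p → subst₂ _<_ (p zero) (p (suc zero)) }
  }
  where open DLO A

module ElementaryEquivalence (em : ExcludedMiddle 0ℓ) where

  ∣_∣ : DLO → Set
  ∣_∣ = DLO.Carrier

  -- The strict lower bounds of the `Q`-entries form a nonempty set without a greatest element, so
  -- `above-finite` finds one of them above all `P`-entries. Both properties of this set come from
  -- the order dual of `above-finite`.
  interpolate : (A : DLO) → let open DLO A in
    ∀ {n} (P Q : Pred (Fin n) 0ℓ) (σ : Vector Carrier n) →
    (∀ {i j} → P i → Q j → σ i < σ j) →
    ∃[ y ] (∀ {j} → Q j → y < σ j) × (∀ {i} → P i → σ i < y)
  interpolate A P Q σ P<Q =
    above-finite linearOrder em (λ y → ∀ {j} → Q j → y < σ j)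
      (let y , _ , y<Q = lowerBound (λ _ → ⊤) (inhabitant , tt)
                           (λ {x} _ → let y , y<x = below x in y , tt , y<x) _
       in y , y<Q)
      -- The dual is applied to the final segment above `x`: it is nonempty because `x` is not
      -- greatest, and density allows descending within it.
      (λ {x} x<Q → let y , x<y , y<Q =
                         lowerBound (x <_) (above x)
                           (λ x<z → let w , x<w , w<z = dense x<z in w , x<w , w<z) x<Q
                   in y , y<Q , x<y)
      P σ (λ Pi Qj → P<Q Pi Qj)
    where
    open DLO A
    lowerBound : (C : Pred Carrier 0ℓ) → ∃ C →
      (∀ {x} → C x → ∃[ y ] C y × y < x) → (∀ {j} → Q j → C (σ j)) →
      ∃[ y ] C y × (∀ {j} → Q j → y < σ j)
    lowerBound C C≢∅ next Q⇒C =
      above-finite (opposite linearOrder) em C C≢∅ next Q σ Q⇒C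

  -- Recording `<` suffices: by trichotomy it also determines which entries are equal.
  Similar : (A B : DLO) → ∀ {n} → Vector ∣ A ∣ n → Vector ∣ B ∣ n → Set
  Similar A B ρ σ = ∀ i j → DLO._<_ A (ρ i) (ρ j) ⇔ DLO._<_ B (σ i) (σ j)

  similar-≡ : (A B : DLO) → ∀ {n} {ρ : Vector ∣ A ∣ n} {σ : Vector ∣ B ∣ n} →
    Similar A B ρ σ → ∀ i j → ρ i ≡ ρ j → σ i ≡ σ j
  similar-≡ A B {σ = σ} sim i j ρi≡ρj with DLO.compare B (σ i) (σ j)
  ... | tri< σi<σj _ _ =
    ⊥-elim (tri⇒irr (DLO.compare A) ρi≡ρj (Equivalence.from (sim i j) σi<σj))
  ... | tri≈ _ σi≡σj _ = σi≡σj
  ... | tri> _ _ σj<σi =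
    ⊥-elim (tri⇒irr (DLO.compare A) (sym ρi≡ρj) (Equivalence.from (sim j i) σj<σi))

  similar-sym : (A B : DLO) → ∀ {n} {ρ : Vector ∣ A ∣ n} {σ : Vector ∣ B ∣ n} →
    Similar A B ρ σ → Similar B A σ ρ
  similar-sym A B sim i j = ⇔-sym (sim i j)

  similar-∷ : (A B : DLO) → ∀ {n} {ρ : Vector ∣ A ∣ n} {σ : Vector ∣ B ∣ n} {x y} →
    Similar A B ρ σ →
    (∀ i → DLO._<_ A (ρ i) x ⇔ DLO._<_ B (σ i) y) →
    (∀ i → DLO._<_ A x (ρ i) ⇔ DLO._<_ B y (σ i)) →
    Similar A B (x ∷ ρ) (y ∷ σ)
  similar-∷ A B sim lower upper zero    zero    =
    mk⇔ (⊥-elim ∘ DLO.irrefl A) (⊥-elim ∘ DLO.irrefl B)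
  similar-∷ A B sim lower upper zero    (suc j) = upper j
  similar-∷ A B sim lower upper (suc i) zero    = lower i
  similar-∷ A B sim lower upper (suc i) (suc j) = sim i j

  -- The forth step. An `x` among the entries of `ρ` is matched by the corresponding entry of `σ`.
  -- Any other `x` cuts `ρ` in two, and by trichotomy it is enough to take `y` in the corresponding
  -- cut of `σ`.
  extend : (A B : DLO) → ∀ {n} {ρ : Vector ∣ A ∣ n} {σ : Vector ∣ B ∣ n} →
    Similar A B ρ σ → ∀ x → ∃[ y ] Similar A B (x ∷ ρ) (y ∷ σ)
  extend A B {n} {ρ} {σ} sim x with em {∃[ i ] ρ i ≡ x}
  ... | yes (i , refl) =
    σ i , similar-∷ A B {ρ = ρ} {σ} sim (λ j → sim j i) (λ j → sim i j)
  ... | no x∉ρ with interpolate B (λ i → ρ i A.< x) (λ j → x A.< ρ j) σ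
                      (λ {i} {j} ρi<x x<ρj →
                        Equivalence.to (sim i j) (A.<-trans ρi<x x<ρj))
    where module A = DLO A
  ...   | y , y<σ , σ<y = y , similar-∷ A B {ρ = ρ} {σ} sim
      (λ i → mk⇔ σ<y (lower i)) (λ i → mk⇔ y<σ (upper i))
    where
    module A = DLO A
    module B = DLO B
    lower : ∀ i → σ i B.< y → ρ i A.< x
    lower i σi<y with A.compare (ρ i) x
    ... | tri< ρi<x _ _ = ρi<x
    ... | tri≈ _ ρi≡x _ = ⊥-elim (x∉ρ (i , ρi≡x))
    ... | tri> _ _ x<ρi = ⊥-elim (B.irrefl (B.<-trans (y<σ x<ρi) σi<y))
    upper : ∀ i → y B.< σ i → x A.< ρ i
    upper i y<σi with A.compare x (ρ i)
    ... | tri< x<ρi _ _ = x<ρi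
    ... | tri≈ _ x≡ρi _ = ⊥-elim (x∉ρ (i , sym x≡ρi))
    ... | tri> _ _ ρi<x = ⊥-elim (B.irrefl (B.<-trans (σ<y ρi<x) y<σi))

  -- Induction on formulas with `A` and `B` free to be swapped: the premise of an implication is
  -- transferred backwards, and a point of `B` instantiating a quantifier is matched in `A` by
  -- `extend`. All terms are variables, there being no function symbols.
  transfer : (A B : DLO) → ∀ {n} {ρ : Vector ∣ A ∣ n} {σ : Vector ∣ B ∣ n} →
    Similar A B ρ σ → ∀ φ →
    Satisfies (orderStructure A) ρ φ → Satisfies (orderStructure B) σ φ
  transfer A B sim (var i ≈′ var j) p = similar-≡ A B sim i j p
  transfer A B sim (rel less ts) p with ts zero | ts (suc zero)
  ... | var i | var j = Equivalence.to (sim i j) p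
  transfer A B sim (φ ⇒′ ψ) f =
    transfer A B sim ψ ∘ f ∘ transfer B A (similar-sym A B sim) φ
  transfer A B sim (∀′ φ) f y =
    let x , sim′ = extend B A (similar-sym A B sim) y
    in transfer A B (similar-sym B A sim′) φ (f x)

  dlo-≡ₑ : (A B : DLO) → orderStructure A ≡ₑ orderStructure B
  dlo-≡ₑ A B φ = mk⇔ (transfer A B (λ ()) φ) (transfer B A (λ ()) φ)

-- Codings into the natural numbers and into binary sequences.

double : ℕ → ℕ
double zero    = zero
double (suc n) = suc (suc (double n))

double-injective : ∀ {m n} → double m ≡ double n → m ≡ n
double-injective {zero}  {zero}  _ = refl
double-injective {suc m} {suc n} p =
  cong suc (double-injective (ℕ.suc-injective (ℕ.suc-injective p)))

double≢suc-double : ∀ m n → double m ≢ suc (double n)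
double≢suc-double (suc m) (suc n) p =
  double≢suc-double m n (ℕ.suc-injective (ℕ.suc-injective p))

-- (m , n) ↦ 2ᵐ(2n + 1)
ℕ×ℕ↣ℕ : (ℕ × ℕ) ↣ ℕ
ℕ×ℕ↣ℕ = mk↣ {to = to} injective
  where
  to : ℕ × ℕ → ℕ
  to (zero  , n) = suc (double n)
  to (suc m , n) = double (to (m , n))
  injective : Injective _≡_ _≡_ to
  injective {zero  , m} {zero  , n} p =
    cong (zero ,_) (double-injective (ℕ.suc-injective p))
  injective {zero  , m} {suc j , n} p = ⊥-elim (double≢suc-double _ m (sym p))
  injective {suc i , m} {zero  , n} p = ⊥-elim (double≢suc-double _ n p)
  injective {suc i , m} {suc j , n} p with injective {i , m} {j , n} (double-injective p)
  ... | refl = refl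

-- The tag 0 or 1 records the sign. Coprimality is proof-irrelevant, so sign, numerator and
-- denominator determine the rational.
ℚ↣ℕ : ℚ ↣ ℕ
ℚ↣ℕ = ℕ×ℕ↣ℕ ↣-∘ ((ℕ×ℕ↣ℕ ×-↣ ↣-id ℕ) ↣-∘ mk↣ {to = to} injective)
  where
  to : ℚ → (ℕ × ℕ) × ℕ
  to (mkℚ (+ n)    d _) = (0 , n) , d
  to (mkℚ -[1+ n ] d _) = (1 , n) , d
  injective : Injective _≡_ _≡_ to
  injective {mkℚ (+ _)    _ _} {mkℚ (+ _)    _ _} refl = refl
  injective {mkℚ -[1+ _ ] _ _} {mkℚ -[1+ _ ] _ _} refl = refl

-- The number is written in unary before the sequence, as a run of `true` closed by one `false`, so
-- that both can be read back.
prefix : ℕ → (ℕ → Bool) → ℕ → Bool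
prefix zero    s zero    = false
prefix zero    s (suc m) = s m
prefix (suc n) s zero    = true
prefix (suc n) s (suc m) = prefix n s m

prefix-injective : ∀ m n {s t} → (∀ i → prefix m s i ≡ prefix n t i) →
  m ≡ n × (∀ i → s i ≡ t i)
prefix-injective zero    zero    p = refl , p ∘ suc
prefix-injective zero    (suc n) p with () ← p zero
prefix-injective (suc m) zero    p with () ← p zero
prefix-injective (suc m) (suc n) p with prefix-injective m n (p ∘ suc)
... | refl , s≗t = refl , s≗t

×≼2^ω : ∀ {X Y : Set} → setoid X ≼ 2^ω → Y ↣ ℕ → setoid (X × Y) ≼ 2^ω
×≼2^ω f g = record
  { to        = λ { (x , y) → prefix (g.to y) (f.to x) }
  ; cong      = λ { refl _ → refl }
  ; injective = λ { {_ , y} {_ , z} p →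
      let gy≡gz , fx≗ = prefix-injective (g.to y) (g.to z) p
      in cong₂ _,_ (f.injective fx≗) (g.injective gy≡gz) }
  }
  where
  module f = Injection f
  module g = Injection g

-- Lexicographic products with the rationals.

ℚ-linearOrder : LinearOrder
ℚ-linearOrder = record
  { Carrier = ℚ
  ; _<_     = ℚ._<_
  ; <-trans = ℚ.<-trans
  ; compare = ℚ.<-cmp
  }

-- Density and the absence of endpoints come from the copies of `ℚ`, so `A` may be any linear order
-- with a point.
_×ℚ : (A : LinearOrder) → LinearOrder.Carrier A → DLO
(A ×ℚ) a = record
  { linearOrder = A ×ₗₑₓ ℚ-linearOrder
  ; inhabitant  = a , 0ℚ
  ; dense       = λ
      { {x , p} (inj₁ x<y) →
          let q , p<q = ℚ-above p in (x , q) , inj₂ (refl , p<q) , inj₁ x<y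
      ; {x , p} (inj₂ (refl , p<r)) →
          let q , p<q , q<r = ℚ.<-dense p<r
          in (x , q) , inj₂ (refl , p<q) , inj₂ (refl , q<r) }
  ; below       = λ { (x , p) → let q , q<p = ℚ-below p in (x , q) , inj₂ (refl , q<p) }
  ; above       = λ { (x , p) → let q , p<q = ℚ-above p in (x , q) , inj₂ (refl , p<q) }
  }
  where
  ℚ-above : ∀ p → ∃[ q ] p ℚ.< q
  ℚ-above p = p ℚ.+ 1ℚ ,
    subst (ℚ._< p ℚ.+ 1ℚ) (ℚ.+-identityʳ p) (ℚ.+-monoʳ-< p (ℚ.positive⁻¹ 1ℚ))
  ℚ-below : ∀ p → ∃[ q ] q ℚ.< p
  ℚ-below p = p ℚ.+ ℚ.- 1ℚ ,
    subst (p ℚ.+ ℚ.- 1ℚ ℚ.<_) (ℚ.+-identityʳ p)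
      (ℚ.+-monoʳ-< p (ℚ.negative⁻¹ (ℚ.- 1ℚ)))

-- Ordinals with propositional equality, and successor cardinals.

record Ordinal : Set₁ where
  field
    linearOrder : LinearOrder
  open LinearOrder linearOrder public
  field
    wellFounded : WellFounded _<_

  segment : Carrier → Setoid 0ℓ 0ℓ
  segment x = On.setoid {B = Σ[ y ∈ Carrier ] y < x} (setoid Carrier) proj₁

ℕ-ordinal : Ordinal
ℕ-ordinal = record
  { linearOrder = record
      { Carrier = ℕ ; _<_ = ℕ._<_ ; <-trans = ℕ.<-trans ; compare = ℕ.<-cmp }
  ; wellFounded = ℕ.<-wellFounded
  }

_×ₒ_ : Ordinal → Ordinal → Ordinal
A ×ₒ B = record
  { linearOrder = A.linearOrder ×ₗₑₓ B.linearOrder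
  ; wellFounded = ×-wellFounded A.wellFounded B.wellFounded
  }
  where
  module A = Ordinal A
  module B = Ordinal B

pullback : ∀ {X : Set} (A : Ordinal) → X ↣ Ordinal.Carrier A → Ordinal
pullback A f = record
  { linearOrder = record
      { Carrier = _
      ; _<_     = A._<_ on f.to
      ; <-trans = A.<-trans
      ; compare = compare
      }
  ; wellFounded = On.wellFounded f.to A.wellFounded
  }
  where
  module A = Ordinal A
  module f = Injection f
  compare : Trichotomous _≡_ (A._<_ on f.to)
  compare x y with A.compare (f.to x) (f.to y)
  ... | tri< a b c = tri< a (b ∘ cong f.to) c
  ... | tri≈ a b c = tri≈ a (f.injective b) c
  ... | tri> a b c = tri> a (b ∘ cong f.to) c

-- The order type of `W` is the Hartogs number of `V`, the least ordinal that does not inject into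
-- `V`.
IsSuccessor : Set → Ordinal → Set
IsSuccessor V W =
  ¬ (Ordinal.Carrier W ↣ V) × (∀ w → Ordinal.segment W w ≼ setoid V)

-- An infinite cardinal equal to its square, as the proof of regularity requires.
record Idempotent (V : Set) : Set where
  field
    ℕ↣V   : ℕ ↣ V
    V×V↣V : (V × V) ↣ V

ℕ-idempotent : Idempotent ℕ
ℕ-idempotent = record { ℕ↣V = ↣-id ℕ ; V×V↣V = ℕ×ℕ↣ℕ }

-- Least elements and greedy embeddings of well-orders.

module Classical (em : ExcludedMiddle 0ℓ) where

  ¬∀⇒∃¬ : ∀ {X : Set} {P : Pred X 0ℓ} → ¬ (∀ x → P x) → ∃[ x ] ¬ P x
  ¬∀⇒∃¬ ¬∀ = decidable-stable em λ ¬∃ →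
    ¬∀ λ x → decidable-stable em λ ¬Px → ¬∃ (x , ¬Px)

  module Least (V : Ordinal) where
    open Ordinal V

    IsLeast : Pred Carrier 0ℓ → Pred Carrier 0ℓ
    IsLeast P x = P x × (∀ {y} → P y → ¬ (y < x))

    least : ∀ {P x} → P x → ∃ (IsLeast P)
    least {P} {x} = go (wellFounded x)
      where
      go : ∀ {x} → Acc _<_ x → P x → ∃ (IsLeast P)
      go {x} (acc rs) Px with em {∃[ y ] P y × y < x}
      ... | yes (y , Py , y<x) = go (rs y<x) Py
      ... | no  ¬smaller = x , Px , λ Py y<x → ¬smaller (_ , Py , y<x)

    -- Two equivalent predicates are allowed because, without function extensionality, pointwise
    -- equal functions give avoidance predicates that are merely equivalent.
    least-unique : ∀ {P Q x y} → (∀ {z} → P z → Q z) → (∀ {z} → Q z → P z) →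
      IsLeast P x → IsLeast Q y → x ≡ y
    least-unique {x = x} {y} P⇒Q Q⇒P (Px , x≤) (Qy , y≤) with compare x y
    ... | tri< x<y _ _ = ⊥-elim (y≤ (P⇒Q Px) x<y)
    ... | tri≈ _ x≡y _ = x≡y
    ... | tri> _ _ y<x = ⊥-elim (x≤ (Q⇒P Qy) y<x)

  -- Map each w to the least element that is not yet a value.
  module Greedy (W V : Ordinal) where
    private
      module W = Ordinal W
      module V = Ordinal V
    open Least V

    module _ (small : ∀ w → ¬ (Σ[ g ∈ (V.Carrier ↣ W.Carrier) ]
                                 (∀ v → Injection.to g v W.< w))) where

      -- Recomputing makes the value at v independent of the proof of v < w.
      Avoids : ∀ {w} → WfRec W._<_ (λ _ → V.Carrier) w → Pred V.Carrier 0ℓ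
      Avoids {w} f x = ∀ {v} (v<w : v W.< w) → f (recompute em v<w) ≢ x

      avoids-≡ : ∀ {w} {f g : WfRec W._<_ (λ _ → V.Carrier) w} →
        (∀ {v} (v<w : v W.< w) → f v<w ≡ g v<w) → ∀ {x} → Avoids f x → Avoids g x
      avoids-≡ f≗g f≢x v<w gv≡x = f≢x v<w (trans (f≗g _) gv≡x)

      fresh : ∀ w (f : WfRec W._<_ (λ _ → V.Carrier) w) → ∃ (IsLeast (Avoids f))
      fresh w f with em {∃ (Avoids f)}
      ... | yes (_ , avoids) = least {P = Avoids f} avoids
      -- Were every element already a value, sending each to an argument that produces it would
      -- inject `V` below `w`.
      ... | no  ¬avoids = ⊥-elim (small w (mk↣ injective , λ x → proj₁ (proj₂ (hit x))))
        where
        hit : ∀ x → ∃[ v ] Σ[ v<w ∈ v W.< w ] f (recompute em v<w) ≡ x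
        hit x = decidable-stable em λ ¬hit →
          ¬avoids (x , λ v<w fv≡x → ¬hit (_ , v<w , fv≡x))
        injective : Injective _≡_ _≡_ (proj₁ ∘ hit)
        injective {x} {y} p with hit x | hit y
        injective refl | _ , _ , fv≡x | _ , _ , fv≡y = trans (sym fv≡x) fv≡y

      next : ∀ w → WfRec W._<_ (λ _ → V.Carrier) w → V.Carrier
      next w f = proj₁ (fresh w f)

      -- The extensionality condition under which well-founded recursion unfolds.
      next-ext : ∀ w {f g : WfRec W._<_ (λ _ → V.Carrier) w} →
        (∀ {v} (v<w : v W.< w) → f v<w ≡ g v<w) → next w f ≡ next w g
      next-ext w {f} {g} f≗g = least-unique {P = Avoids f} {Q = Avoids g}
        (avoids-≡ {f = f} {g} f≗g)
        (avoids-≡ {f = g} {f} (λ v<w → sym (f≗g v<w)))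
        (proj₂ (fresh w f)) (proj₂ (fresh w g))

      open All W.wellFounded 0ℓ using (wfRec)
      open FixPoint W.wellFounded (λ _ → V.Carrier) next next-ext using (unfold-wfRec)

      embed : W.Carrier → V.Carrier
      embed = wfRec _ next

      embed-distinct : ∀ {v w} → v W.< w → embed v ≢ embed w
      embed-distinct {w = w} v<w p =
        proj₁ (proj₂ (fresh w (λ {v} _ → embed v))) v<w (trans p unfold-wfRec)

      greedy : W.Carrier ↣ V.Carrier
      greedy = mk↣ {to = embed} injective
        where
        injective : Injective _≡_ _≡_ embed
        injective {v} {w} p with W.compare v w
        ... | tri< v<w _ _ = ⊥-elim (embed-distinct v<w p)
        ... | tri≈ _ v≡w _ = v≡w
        ... | tri> _ _ w<v = ⊥-elim (embed-distinct w<v (sym p))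

  open Greedy using (greedy)

  -- Regularity of successor cardinals.

  module Successor (V : Set) (W : Ordinal) (V-idem : Idempotent V)
                   (W-succ : IsSuccessor V W) where
    open Ordinal W
    open Idempotent V-idem

    private
      module pair = Injection V×V↣V
      module seg {w} = Injection (proj₂ W-succ w)
      module num = Injection ℕ↣V

    pair-injective : ∀ {a b c d} → pair.to (a , b) ≡ pair.to (c , d) → a ≡ c × b ≡ d
    pair-injective p with pair.injective p
    ... | refl = refl , refl

    -- Tag 1 marks the elements strictly below `w`, tag 0 marks `w` itself.
    closedSegment : ∀ w y → ¬ (w < y) → V
    closedSegment w y w≮y with compare y w
    ... | tri< y<w _ _ = pair.to (num.to 1 , seg.to (y , y<w))
    ... | tri≈ _ _ _   = pair.to (num.to 0 , num.to 0)
    ... | tri> _ _ w<y = ⊥-elim (w≮y w<y)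

    closedSegment-injective : ∀ {w w′ y z} (p : ¬ (w < y)) (q : ¬ (w′ < z)) →
      w ≡ w′ → closedSegment w y p ≡ closedSegment w′ z q → y ≡ z
    closedSegment-injective {w} {_} {y} {z} w≮y w≮z refl eq
      with compare y w | compare z w
    ... | tri< _ _ _   | tri< _ _ _   = seg.injective (proj₂ (pair-injective eq))
    ... | tri< _ _ _   | tri≈ _ _ _   with () ← num.injective (proj₁ (pair-injective eq))
    ... | tri≈ _ _ _   | tri< _ _ _   with () ← num.injective (proj₁ (pair-injective eq))
    ... | tri≈ _ y≡w _ | tri≈ _ z≡w _ = trans y≡w (sym z≡w)
    ... | tri> _ _ w<y | _            = ⊥-elim (w≮y w<y)
    ... | _            | tri> _ _ w<z = ⊥-elim (w≮z w<z)

    -- If `h` were unbounded, every `b` would lie in the closed segment of some `h i`. Coding `b` by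
    -- `i` and its place in that segment would inject `W` into `V × V`, hence into `V`.
    bounded : ∀ {I : Set} → I ↣ V → (h : I → Carrier) → ∃[ b ] (∀ i → h i < b)
    bounded {I} I↣V h = decidable-stable em λ ¬bounded →
      let unbounded : ∀ b → ∃[ i ] ¬ (h i < b)
          unbounded b = ¬∀⇒∃¬ λ h<b → ¬bounded (b , h<b)
          code b = let i , hi≮b = unbounded b in
                   pair.to (Injection.to I↣V i , closedSegment (h i) b hi≮b)
      in proj₁ W-succ (mk↣ {to = code} λ {b} {c} p →
           let eq₁ , eq₂ = pair-injective p
           in closedSegment-injective _ _ (cong h (Injection.injective I↣V eq₁)) eq₂)

  -- The square of ℵ₁.

  -- Gödel's well-order of W × W, with any strict upper bound of the two
  -- coordinates in place of their maximum.
  successor-idempotent : ∀ W → IsSuccessor ℕ W → Idempotent (Ordinal.Carrier W)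
  successor-idempotent W W-succ = record
    { ℕ↣V   = greedy ℕ-ordinal W λ { _ (g , _) → proj₁ W-succ g }
    ; V×V↣V = greedy (pullback (W ×ₒ (W ×ₒ W)) triple) W small
    }
    where
    open Ordinal W
    open Successor ℕ W ℕ-idempotent W-succ
    upper : ∀ x y → ∃[ m ] x < m × y < m
    upper x y = let m , <m = bounded (↣-id ℕ) (λ { zero → x ; (suc _) → y })
                in m , <m 0 , <m 1
    triple : (Carrier × Carrier) ↣ (Carrier × (Carrier × Carrier))
    triple = mk↣ {to = λ { (x , y) → proj₁ (upper x y) , x , y }} (cong proj₂)
    open Ordinal (pullback (W ×ₒ (W ×ₒ W)) triple) using () renaming (_<_ to _⊏_)
    -- Pairs preceding a given one have both coordinates below a fixed `s`, whose segment is
    -- countable. An injection of `W` into them would make `W` countable.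
    small : ∀ w → ¬ (Σ[ g ∈ (Carrier ↣ (Carrier × Carrier)) ]
                       (∀ v → Injection.to g v ⊏ w))
    small (x , y) (g , g<) = proj₁ W-succ (ℕ×ℕ↣ℕ ↣-∘ mk↣ {to = code} injective)
      where
      module g = Injection g
      m = proj₁ (upper x y)
      -- A preceding pair may have the same bound `m`, so `s` is taken strictly above `m`.
      s = proj₁ (upper m m)
      m<s = proj₁ (proj₂ (upper m m))
      module seg = Injection (proj₂ W-succ s)
      bound<s : ∀ v → proj₁ (upper (proj₁ (g.to v)) (proj₂ (g.to v))) < s
      bound<s v = [ (λ m′<m → <-trans m′<m m<s)
                  , (λ (m′≡m , _) → subst (_< s) (sym m′≡m) m<s) ]′ (g< v)
      fst<s : ∀ v → proj₁ (g.to v) < s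
      fst<s v = <-trans (proj₁ (proj₂ (upper _ _))) (bound<s v)
      snd<s : ∀ v → proj₂ (g.to v) < s
      snd<s v = <-trans (proj₂ (proj₂ (upper _ _))) (bound<s v)
      code : Carrier → ℕ × ℕ
      code v = seg.to (_ , fst<s v) , seg.to (_ , snd<s v)
      injective : Injective _≡_ _≡_ code
      injective p = g.injective
        (cong₂ _,_ (seg.injective (cong proj₁ p)) (seg.injective (cong proj₂ p)))

-- From setoids to types with propositional equality.

-- A setoid section of the quotient map X → S picks canonical representatives,
-- whose propositional equality is the equality of S.
record Representatives (S : Setoid 0ℓ 0ℓ) : Set₁ where
  open Setoid S using (Carrier; _≈_; reflexive)
  field
    Rep        : Set
    [_]        : Carrier → Rep
    rep        : Rep → Carrier
    []-cong    : ∀ {x y} → x ≈ y → [ x ] ≡ [ y ]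
    rep-[]     : ∀ x → rep [ x ] ≈ x
    []-rep     : ∀ a → [ rep a ] ≡ a

  rep-injective : ∀ {a b} → rep a ≈ rep b → a ≡ b
  rep-injective {a} {b} p = trans (sym ([]-rep a)) (trans ([]-cong p) ([]-rep b))

  rep-≼ : setoid Rep ≼ S
  rep-≼ = record
    { to = rep ; cong = λ { refl → Setoid.refl S } ; injective = rep-injective }

  ≼-[] : S ≼ setoid Rep
  ≼-[] = record
    { to        = [_]
    ; cong      = []-cong
    ; injective = λ {x} {y} p → Setoid.trans S (Setoid.sym S (rep-[] x))
                    (Setoid.trans S (reflexive (cong rep p)) (rep-[] y))
    }

-- Choice is applied to the identity, a surjection from the carrier under propositional equality.
-- Its section `r` makes equivalent elements identical, and the representatives are its fixed
-- points.
representatives : AxiomOfChoice 0ℓ 0ℓ 0ℓ 0ℓ → ∀ S → Representatives S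
representatives ac S = record
  { Rep     = Σ[ x ∈ Carrier ] r x ≡ x
  ; [_]     = λ x → r x , Func.cong section (r≈ x)
  ; rep     = proj₁
  ; []-cong = λ p → rep-≡ (Func.cong section p)
  ; rep-[]  = r≈
  ; []-rep  = λ { (x , p) → rep-≡ p }
  }
  where
  open Setoid S using (Carrier; _≈_)
  chosen = ac {A = setoid Carrier} {B = S} record
    { to         = λ x → x
    ; cong       = λ { refl → Setoid.refl S }
    ; surjective = λ y → y , λ { refl → Setoid.refl S }
    }
  section = proj₁ chosen
  r = Func.to section
  r≈ : ∀ x → r x ≈ x
  r≈ = proj₂ chosen
  rep-≡ : ∀ {x y} {p : r x ≡ x} {q : r y ≡ y} → x ≡ y →
          _≡_ {A = Σ[ x ∈ Carrier ] r x ≡ x} (x , p) (y , q)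
  rep-≡ {p = p} {q} refl = cong (_ ,_) (uip p q)

-- ℵ₁ and ℵ₂ as ordinals on representatives.

module Alephs (ac : AxiomOfChoice 0ℓ 0ℓ 0ℓ 0ℓ) where

  module R (α : WellOrder) = Representatives (representatives ac (WellOrder.setoid α))

  toOrdinal : WellOrder → Ordinal
  toOrdinal α = record
    { linearOrder = record
        { Carrier = R.Rep α
        ; _<_     = α._<_ on R.rep α
        ; <-trans = STO.trans
        ; compare = compare
        }
    ; wellFounded = On.wellFounded (R.rep α) α.wellFounded
    }
    where
    module α = WellOrder α
    module STO = StrictTotalOrder α.strictTotalOrder
    compare : Trichotomous _≡_ (α._<_ on R.rep α)
    compare a b with STO.compare (R.rep α a) (R.rep α b)
    ... | tri< p q r = tri< p (λ { refl → q STO.Eq.refl }) r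
    ... | tri≈ p q r = tri≈ p (R.rep-injective α q) r
    ... | tri> p q r = tri> p (λ { refl → q STO.Eq.refl }) r

  -- Serves both levels: `S` is a copy of ℵ₀ with `V` the natural numbers, or a copy of ℵ₁ with `V`
  -- its representatives.
  toOrdinal-isSuccessor : ∀ {V : Set} (α : WellOrder) {S : Setoid 0ℓ 0ℓ} →
    S ≼ setoid V → setoid V ≼ S →
    ¬ (WellOrder.setoid α ≼ S) → (∀ x → WellOrder.segment α x ≼ S) →
    IsSuccessor V (toOrdinal α)
  toOrdinal-isSuccessor α S≼V V≼S α⋠S segment≼S =
      (λ f → α⋠S (injection (R.≼-[] α) (injection f V≼S)))
    , (λ a → injection (segment-rep a) (injection (segment≼S (R.rep α a)) S≼V))
    where
    segment-rep : ∀ a → Ordinal.segment (toOrdinal α) a ≼ WellOrder.segment α (R.rep α a)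
    segment-rep a = record
      { to        = λ { (b , b<a) → R.rep α b , b<a }
      ; cong      = λ { refl → Setoid.refl (WellOrder.setoid α) }
      ; injective = R.rep-injective α
      }

  ℵ₁-isSuccessor : ∀ κ → IsAleph 1 κ → IsSuccessor ℕ (toOrdinal κ)
  ℵ₁-isSuccessor κ (κ₀ , lift (f , iso) , κ⋠κ₀ , segment≼κ₀) =
    toOrdinal-isSuccessor κ
      (record { to = f ; cong = iso.cong ; injective = iso.injective })
      (record
        { to        = λ n → proj₁ (iso.surjective n)
        ; cong      = λ { refl → Setoid.refl (WellOrder.setoid κ₀) }
        ; injective = λ {m} {n} p →
            trans (sym (proj₂ (iso.surjective m) (Setoid.refl (WellOrder.setoid κ₀))))
                  (proj₂ (iso.surjective n) p)
        })
      κ⋠κ₀ segment≼κ₀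
    where module iso = IsOrderIsomorphism iso

-- Ultrapowers distinguished by cofinality.

module _ (em : ExcludedMiddle 0ℓ) where
  open Classical em
  open ElementaryEquivalence em using (dlo-≡ₑ)

  keisler-fails : (K A : Ordinal) → IsSuccessor ℕ K →
    IsSuccessor (Ordinal.Carrier K) A → setoid (Ordinal.Carrier A) ≼ 2^ω → ¬ KeislerCriterion
  keisler-fails K A K-succ A-succ A≼2^ω keisler = absurd
    (Equivalence.to
      (keisler orderLanguage orderLanguage-countable
        (orderStructure M) (orderStructure N)
        (×≼2^ω (injection K↣A A≼2^ω) ℚ↣ℕ) (×≼2^ω A≼2^ω ℚ↣ℕ))
      (dlo-≡ₑ M N))
    where
    module K = Ordinal K
    module A = Ordinal A
    K-idem : Idempotent K.Carrier
    K-idem = successor-idempotent K K-succ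
    module K-bounded = Successor ℕ K ℕ-idempotent K-succ
    module A-bounded = Successor K.Carrier A K-idem A-succ
    K↣A : K.Carrier ↣ A.Carrier
    -- The greedy map never runs out of values, since `A` does not inject even into the whole of
    -- `K`.
    K↣A = Greedy.greedy K A λ { _ (g , _) → proj₁ A-succ g }
    k₀ : K.Carrier
    k₀ = Injection.to (Idempotent.ℕ↣V K-idem) 0
    M N : DLO
    M = (K.linearOrder ×ℚ) k₀
    N = (A.linearOrder ×ℚ) (Injection.to K↣A k₀)
    module M = DLO M
    module N = DLO N
    M-bounded : (x : ℕ → M.Carrier) → ∃[ k ] (∀ n → x n M.< (k , 0ℚ))
    M-bounded x = let k , x<k = K-bounded.bounded (↣-id ℕ) (proj₁ ∘ x)
                  in k , inj₁ ∘ x<k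
    N-bounded : (y : ℕ → N.Carrier) → ∃[ a ] (∀ n → y n N.< (a , 0ℚ))
    N-bounded y = let a , y<a = A-bounded.bounded (Idempotent.ℕ↣V K-idem) (proj₁ ∘ y)
                  in a , inj₁ ∘ y<a
    absurd : ¬ (Σ[ 𝒰 ∈ Ultrafilter ] (orderStructure M ^ω/ 𝒰) ≃ (orderStructure N ^ω/ 𝒰))
    -- At an index in both large sets, `(b , 0ℚ)` lies below `to (diagonal k) n`, which lies below
    -- `(h k , 0ℚ)` and so below `(b , 0ℚ)` again. The intersection is thus empty, although large.
    absurd (𝒰 , iso) = proper (upward
        (λ { {n} (Φx<Φk , Φx≡b) →
             N.irrefl (N.<-trans (subst (N._< to (diagonal k) n) Φx≡b Φx<Φk)
                        (N.<-trans (proj₂ (N-bounded (to (diagonal k))) n) (inj₁ (h<b k)))) })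
        (meet Φx<Φk-large (proj₂ preimage {x} (upward (λ _ → refl) universal))))
      where
      open Ultrafilter 𝒰
      open _≃_ iso
      open Bijection bijection using (surjective)
      diagonal : K.Carrier → ℕ → M.Carrier
      diagonal k _ = k , 0ℚ
      -- Bounds the image of `diagonal k` at every index. Regularity of `A` then puts all these
      -- bounds below a single `b`.
      h : K.Carrier → A.Carrier
      h k = proj₁ (N-bounded (to (diagonal k)))
      b : A.Carrier
      b = proj₁ (A-bounded.bounded (↣-id _) h)
      h<b : ∀ k → h k A.< b
      h<b = proj₂ (A-bounded.bounded (↣-id _) h)
      -- The constant sequence at `b` exceeds the image of every diagonal, yet its preimage `x` lies
      -- below some `diagonal k`.
      preimage = surjective (λ _ → b , 0ℚ)
      x = proj₁ preimage
      k = proj₁ (M-bounded x)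
      Φx<Φk-large : Large (λ n → to x n N.< to (diagonal k) n)
      Φx<Φk-large = Equivalence.to (rel-homo less (x ∷ diagonal k ∷ []))
        (upward (λ {n} _ → proj₂ (M-bounded x) n) universal)

theorem1p1 : (∀ {ℓ} → ExcludedMiddle ℓ) →
    (∀ {a ℓ₁ b ℓ₂} → AxiomOfChoice a ℓ₁ b ℓ₂) →
    2^ℵ₀≥ℵ₂ → ¬ KeislerCriterion
theorem1p1 em ac (α , (κ , κ-ℵ₁ , α⋠κ , segment≼κ) , α≼2^ω) =
  keisler-fails em (toOrdinal κ) (toOrdinal α)
    (ℵ₁-isSuccessor κ κ-ℵ₁)
    (toOrdinal-isSuccessor α (R.≼-[] κ) (R.rep-≼ κ) α⋠κ segment≼κ)
    (injection (R.rep-≼ α) α≼2^ω)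
  where open Alephs ac
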